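{- Let $\Gamma$ be a commutative thick weakly distance-regular digraph and $q$ an integer. The configuration C$(q)$ or the configuration D$(q)$ exists if and only if $(1,q-1)$ is mixed.
   Context: All digraphs are finite, simple, strongly connected. $\partial(x,y)$ is the directed distance, $\tilde\partial(x,y)=(\partial(x,y),\partial(y,x))$, $\tilde\partial(\Gamma)$ the set of all such pairs; $\Gamma_{a,b}=\{(x,y)\mid\tilde\partial(x,y)=(a,b)\}$, $\Gamma_{a,b}(x)=\{y\mid(x,y)\in\Gamma_{a,b}\}$. Weakly distance-regular: for $\tilde h,\tilde i,\tilde j\in\tilde\partial(\Gamma)$, the number $p^{\tilde h}_{\tilde i,\tilde j}$ of $z$ with $\tilde\partial(x,z)=\tilde i,\tilde\partial(z,y)=\tilde j$ depends only on $\tilde h=\tilde\partial(x,y)$ (an intersection number involving a pair outside $\tilde\partial(\Gamma)$ is taken as $0$); commutative: $p^{\tilde h}_{\tilde i,\tilde j}=p^{\tilde h}_{\tilde j,\tilde i}$; $k_{\tilde i}=|\Gamma_{\tilde i}(x)|$; thick: $p^{\tilde h}_{\tilde i,\tilde i},p^{\tilde h}_{\tilde i,\tilde i^*}\in\{0,k_{\tilde i}\}$ where $(a,b)^*=(b,a)$. An arc $(u,v)$ is of type $(1,q-1)$ if $\partial(v,u)=q-1$. Such an arc is pure if every circuit (closed directed walk) of length $q$ containing it consists of arcs of type $(1,q-1)$, and mixed otherwise; $(1,q-1)$ is pure if every arc of type $(1,q-1)$ is pure, otherwise mixed. C$(q)$ exists if $p^{(1,q-2)}_{(1,q-1),(1,q-1)}\neq0$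 and $(1,q-2)$ is pure; D$(q)$ exists if $p^{(1,q-1)}_{(1,q-2),(q-2,1)}\ne0$ and $(1,q-2)$ is pure. -}

module Defs where

open import Data.Bool using (Bool; true; false; _∧_; if_then_else_)
open import Data.Nat using (ℕ; zero; suc; _∸_; _≡ᵇ_)
open import Data.Fin using (Fin; zero; suc; inject₁; fromℕ; _≟_)
open import Data.List using (List; length; filterᵇ; allFin)
open import Data.Bool.ListAction using (any)
open import Data.Product using (_×_; _,_; ∃; ∃-syntax; Σ)
open import Data.Sum using (_⊎_)
open import Relation.Nullary using (¬_; ⌊_⌋)
open import Relation.Binary.PropositionalEquality using (_≡_; _≢_)

record Digraph : Set where
  field
    n        : ℕ
    adj      : Fin n → Fin n → Bool
    loopless : ∀ x → adj x x ≡ false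

module _ (Γ : Digraph) where
  open Digraph Γ

  V : Set
  V = Fin n

  walkᵇ : ℕ → V → V → Bool
  walkᵇ zero    x y = ⌊ x ≟ y ⌋
  walkᵇ (suc k) x y = any (λ z → adj x z ∧ walkᵇ k z y) (allFin n)

  StronglyConnected : Set
  StronglyConnected = ∀ x y → ∃[ k ] (walkᵇ k x y ≡ true)

  -- directed distance ∂(x,y): least k with a walk of length k from x to y
  -- (searching k = 0 … n-1; in a strongly connected digraph this is always found)
  dist : V → V → ℕ
  dist x y = search n 0
    where
      search : ℕ → ℕ → ℕ
      search zero    d = d
      search (suc f) d = if walkᵇ d x y then d else search f (suc d)

  Pair : Set
  Pair = ℕ × ℕ

  swap : Pair → Pair
  swap (a , b) = (b , a)

  dpair : V → V → Pair
  dpair x y = (dist x y , dist y x)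

  _==ᴾ_ : Pair → Pair → Bool
  (a , b) ==ᴾ (c , d) = (a ≡ᵇ c) ∧ (b ≡ᵇ d)

  count : (V → Bool) → ℕ
  count P = length (filterᵇ P (allFin n))

  pnum : V → V → Pair → Pair → ℕ
  pnum x y i j = count (λ z → (dpair x z ==ᴾ i) ∧ (dpair z y ==ᴾ j))

  kval : V → Pair → ℕ
  kval x i = count (λ z → dpair x z ==ᴾ i)

  WeaklyDistanceRegular : Set
  WeaklyDistanceRegular =
    StronglyConnected ×
    (∀ x y x' y' i j → dpair x y ≡ dpair x' y' → pnum x y i j ≡ pnum x' y' i j)

  Commutative : Set
  Commutative = ∀ x y i j → pnum x y i j ≡ pnum x y j i

  Thick : Set
  Thick = ∀ x y i →
    (pnum x y i i ≡ 0 ⊎ pnum x y i i ≡ kval x i) ×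
    (pnum x y i (swap i) ≡ 0 ⊎ pnum x y i (swap i) ≡ kval x i)

  -- p^h_{i,j} ≠ 0 (for a weakly distance-regular Γ; 0 if h ∉ ∂̃(Γ))
  PNonzero : Pair → Pair → Pair → Set
  PNonzero h i j = ∃[ x ] ∃[ y ] (dpair x y ≡ h × pnum x y i j ≢ 0)

  ArcType : ℕ → V → V → Set
  ArcType m u v = adj u v ≡ true × dist v u ≡ m

  IsCircuit : (L : ℕ) → (Fin (suc L) → V) → Set
  IsCircuit L c = (c zero ≡ c (fromℕ L)) × (∀ (i : Fin L) → adj (c (inject₁ i)) (c (suc i)) ≡ true)

  ContainsArc : (L : ℕ) → (Fin (suc L) → V) → V → V → Set
  ContainsArc L c u v = ∃[ i ] (c (inject₁ i) ≡ u × c (suc i) ≡ v)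

  PureArc : ℕ → V → V → Set
  PureArc m u v = ∀ (c : Fin (suc (suc m)) → V) → IsCircuit (suc m) c →
    ContainsArc (suc m) c u v → ∀ (i : Fin (suc m)) → dist (c (suc i)) (c (inject₁ i)) ≡ m

  Pure : ℕ → Set
  Pure m = ∀ u v → ArcType m u v → PureArc m u v

  Mixed : ℕ → Set
  Mixed m = ¬ Pure m

  ConfC : ℕ → Set
  ConfC q = PNonzero (1 , q ∸ 2) (1 , q ∸ 1) (1 , q ∸ 1) × Pure (q ∸ 2)

  ConfD : ℕ → Set
  ConfD q = PNonzero (1 , q ∸ 1) (1 , q ∸ 2) (q ∸ 2 , 1) × Pure (q ∸ 2)

{-# OPTIONS --safe #-}
module Submission where

-- Write A t for the relation "arc of type (1 , t)".  By thickness and commutativity, having a common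
-- A t-out-neighbour is an equivalence relation K t (equivalently, a common A t-in-neighbour), and A t
-- permutes its classes.  By commutativity the types along a closed walk can be permuted at will, so (1 , r+1)
-- is mixed as soon as some closed walk of length r+2 starts with types r+1 , s for some s ≠ r+1.
-- The first two arcs x → y → z of such a walk satisfy d z x = r, so ∂̃(x , z) is (1 , r) or (2 , r).
-- If it is always (2 , r), then weak distance-regularity allows every type after the first to be replaced
-- by s, and going round s-arcs only is possible only for s = r pure, which is D.
-- If it is (1 , r) and (1 , r) is pure, comparing the possible second types gives C or D.
-- If it is (1 , r) and (1 , r) is mixed, then by induction (1 , r-1) is pure and C or D holds one level
-- lower, and either of them contradicts the existence of the triangle x , y , z.

open import Defs
open import Data.Bool using (Bool; true; false; T; _∧_; if_then_else_)
open import Data.Nat using (ℕ; zero; suc; _+_; _∸_; _≤_; _<_; z≤n; s≤s; _≟_; _<?_)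
open import Data.Nat.Properties
open import Data.Nat.Induction using (<-rec)
open import Data.Bool.Properties using (T-≡; T-∧)
open import Data.Fin as Fin using (Fin; zero; suc; inject₁; fromℕ; toℕ)
open import Data.Fin.Properties using (pigeonhole; toℕ<n; any?)
open import Data.List using (List; []; _∷_; _++_; length; replicate; allFin; filterᵇ; tabulate)
open import Data.List.Properties using (length-replicate; length-tabulate; length-++; ++-identityʳ)
open import Data.List.Membership.Propositional using (_∈_; lose)
open import Data.List.Membership.Propositional.Properties using (∈-allFin; ∈-∃++; ∈-tabulate⁺; ∈-filter⁺; ∈-filter⁻)
open import Data.List.Relation.Unary.Any as Any using (here; there)
open import Data.List.Relation.Unary.Any.Properties using (any⁺; any⁻)
open import Data.List.Relation.Binary.Permutation.Propositional using (_↭_; prep) renaming (refl to ↭-refl; swap to ↭-swap; trans to ↭-trans)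
open import Data.List.Relation.Binary.Permutation.Propositional.Properties using (∈-resp-↭; ↭-length; shift)
open import Data.Product using (_×_; _,_; ∃; ∃-syntax; proj₁; proj₂)
open import Data.Product.Properties using (≡-dec; ,-injective)
open import Data.Empty using (⊥; ⊥-elim)
open import Data.Sum using (_⊎_; inj₁; inj₂)
open import Function using (_∘_)
open import Function.Bundles using (_⇔_; Equivalence; mk⇔)
open import Relation.Binary.PropositionalEquality using (_≡_; _≢_; refl; sym; trans; cong; cong₂; subst)
open import Relation.Nullary using (¬_; yes; no; contradiction)
open import Relation.Nullary.Decidable using (T?; _×-dec_; ¬?; decidable-stable)

-- Bounded search and the distance function

module _ (w : ℕ → Bool) where

  record IsSearch (s : ℕ → ℕ → ℕ) : Set where
    field
      base : ∀ d → s zero d ≡ d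
      step : ∀ f d → s (suc f) d ≡ (if w d then d else s f (suc d))

  open IsSearch

  FirstHit : ℕ → ℕ → Set
  FirstHit N k = (k ≡ N ⊎ w k ≡ true) × (∀ j → j < k → w j ≡ false)

  search-firstHit : ∀ {s} → IsSearch s → ∀ f d → (∀ j → j < d → w j ≡ false) →
    FirstHit (f + d) (s f d)
  search-firstHit S zero d below rewrite base S d = inj₁ refl , below
  search-firstHit S (suc f) d below with w d in eq | step S f d
  ... | true  | e rewrite e = inj₂ eq , below
  ... | false | e rewrite e | sym (+-suc f d) = search-firstHit S f (suc d) below′
    where
    below′ : ∀ j → j < suc d → w j ≡ false
    below′ j j<1+d with m≤n⇒m<n∨m≡n (≤-pred j<1+d)
    ... | inj₁ j<d  = below j j<d
    ... | inj₂ refl = eq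

-- Bundling the endpoints hides the vertex count n from their types; otherwise abstracting n in dist-search
-- would be ill-typed.
record Ends (Γ : Digraph) : Set where
  constructor ends
  field
    source target : V Γ

open Ends

mutual
  search : (Γ : Digraph) → Ends Γ → ℕ → ℕ → ℕ
  -- Unification solves this with the local function in the definition of dist, which cannot be named here.
  search = _

  dist-search : (Γ : Digraph) (e : Ends Γ) (P : ℕ → ℕ → ℕ → Set) →
    (∀ f d → P f d (search Γ e f d)) → P (Digraph.n Γ) 0 (dist Γ (source e) (target e))
  dist-search Γ e P h with Digraph.n Γ | 0
  ... | f | d = h f d

search-isSearch : (Γ : Digraph) (e : Ends Γ) → IsSearch (λ k → walkᵇ Γ k (source e) (target e)) (search Γ e)
search-isSearch Γ e = record { base = λ _ → refl ; step = λ _ _ → refl }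

dist-firstHit : ∀ Γ x y → FirstHit (λ k → walkᵇ Γ k x y) (Digraph.n Γ + 0) (dist Γ x y)
dist-firstHit Γ x y = dist-search Γ (ends x y)
  (λ f d k → (∀ j → j < d → walkᵇ Γ j x y ≡ false) → FirstHit (λ k → walkᵇ Γ k x y) (f + d) k)
  (search-firstHit _ (search-isSearch Γ (ends x y))) (λ _ ())

-- Walks and shortest walks

module Walks (Γ : Digraph) where
  open Digraph Γ

  data Walk : ℕ → V Γ → V Γ → Set where
    []  : ∀ {x} → Walk 0 x x
    _∷_ : ∀ {k x y z} → adj x y ≡ true → Walk k y z → Walk (suc k) x z

  _++ʷ_ : ∀ {k l x y z} → Walk k x y → Walk l y z → Walk (k + l) x z
  []      ++ʷ v = v
  (a ∷ u) ++ʷ v = a ∷ (u ++ʷ v)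

  walkᵇ⇒Walk : ∀ k {x y} → walkᵇ Γ k x y ≡ true → Walk k x y
  walkᵇ⇒Walk zero {x} {y} e with x Fin.≟ y
  ... | yes refl = []
  walkᵇ⇒Walk (suc k) {x} {y} e
    with Any.satisfied (any⁻ (λ z → adj x z ∧ walkᵇ Γ k z y) (allFin n) (Equivalence.from T-≡ e))
  ... | z , t with Equivalence.to T-∧ t
  ... | a , b = Equivalence.to T-≡ a ∷ walkᵇ⇒Walk k (Equivalence.to T-≡ b)

  Walk⇒walkᵇ : ∀ {k x y} → Walk k x y → walkᵇ Γ k x y ≡ true
  Walk⇒walkᵇ {x = x} [] with x Fin.≟ x
  ... | yes _ = refl
  ... | no ¬p = contradiction refl ¬p
  Walk⇒walkᵇ {suc k} {x} {y} (_∷_ {y = z} a w) =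
    Equivalence.to T-≡ (any⁺ _ (lose (∈-allFin z) (Equivalence.from T-≡ (cong₂ _∧_ a (Walk⇒walkᵇ w)))))

  vertex : ∀ {k x y} → Walk k x y → Fin (suc k) → V Γ
  vertex {x = x} w zero   = x
  vertex (a ∷ w) (suc i) = vertex w i

  vertex-last : ∀ {k x y} (w : Walk k x y) → vertex w (fromℕ k) ≡ y
  vertex-last []      = refl
  vertex-last (a ∷ w) = vertex-last w

  vertex-adj : ∀ {k x y} (w : Walk k x y) (i : Fin k) →
    adj (vertex w (inject₁ i)) (vertex w (suc i)) ≡ true
  vertex-adj (a ∷ w) zero    = a
  vertex-adj (a ∷ w) (suc i) = vertex-adj w i

  prefix : ∀ {k x y} (w : Walk k x y) (i : Fin (suc k)) → Walk (toℕ i) x (vertex w i)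
  prefix w       zero    = []
  prefix (a ∷ w) (suc i) = a ∷ prefix w i

  suffix : ∀ {k x y} (w : Walk k x y) (i : Fin (suc k)) → Walk (k ∸ toℕ i) (vertex w i) y
  suffix w       zero    = w
  suffix (a ∷ w) (suc i) = suffix w i

  shorten : ∀ {k x y} → n ≤ k → Walk k x y → ∃[ j ] (j < k × Walk j x y)
  shorten {k} n≤k w with pigeonhole (s≤s n≤k) (vertex w)
  ... | i , j , i<j , e = toℕ i + (k ∸ toℕ j) , lt ,
    (prefix w i ++ʷ subst (λ v → Walk _ v _) (sym e) (suffix w j))
    where
    lt : toℕ i + (k ∸ toℕ j) < k
    lt = <-≤-trans (+-monoˡ-< (k ∸ toℕ j) i<j) (≤-reflexive (m+[n∸m]≡n (≤-pred (toℕ<n j))))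

  shortWalk : ∀ {x y} k → Walk k x y → ∃[ j ] (j < n × Walk j x y)
  shortWalk = <-rec _ go
    where
    go : ∀ {x y} k → (∀ {j} → j < k → Walk j x y → ∃[ i ] (i < n × Walk i x y)) →
      Walk k x y → ∃[ i ] (i < n × Walk i x y)
    go k rec w with k <? n
    ... | yes k<n = k , k<n , w
    ... | no k≮n with shorten (≮⇒≥ k≮n) w
    ... | j , j<k , w′ = rec j<k w′

  dist-≤ : ∀ {k x y} → Walk k x y → dist Γ x y ≤ k
  dist-≤ {k} {x} {y} w with dist-firstHit Γ x y
  ... | _ , below with k <? dist Γ x y
  ... | no k≮d  = ≮⇒≥ k≮d
  ... | yes k<d with trans (sym (below k k<d)) (Walk⇒walkᵇ w)
  ... | ()

  module _ (connected : StronglyConnected Γ) where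

    geodesic : ∀ x y → Walk (dist Γ x y) x y
    geodesic x y with dist-firstHit Γ x y | connected x y
    ... | inj₂ e , _ | _ = walkᵇ⇒Walk _ e
    ... | inj₁ e , _ | k , c with shortWalk k (walkᵇ⇒Walk k c)
    -- An exhausted search would return `n`, but cutting out repeated vertices leaves a walk shorter
    -- than that.
    ... | j , j<n , w = contradiction (dist-≤ w) (<⇒≱ (subst (j <_) (sym (trans e (+-identityʳ n))) j<n))

-- Counting and intersection numbers

module _ {A : Set} (P Q : A → Bool) where

  length-filter-∧-≤ : ∀ xs → length (filterᵇ (λ z → P z ∧ Q z) xs) ≤ length (filterᵇ P xs)
  length-filter-∧-≤ [] = z≤n
  length-filter-∧-≤ (x ∷ xs) with P x | Q x
  ... | true  | true  = s≤s (length-filter-∧-≤ xs)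
  ... | true  | false = m≤n⇒m≤1+n (length-filter-∧-≤ xs)
  ... | false | _     = length-filter-∧-≤ xs

  filter-∧-full : ∀ {z} xs → length (filterᵇ (λ z → P z ∧ Q z) xs) ≡ length (filterᵇ P xs) →
    z ∈ xs → T (P z) → T (Q z)
  filter-∧-full (x ∷ xs) e (here refl) p with P x | Q x
  ... | true | true  = _
  ... | true | false = contradiction (≤-reflexive (sym e)) (≤⇒≯ (length-filter-∧-≤ xs))
  filter-∧-full (x ∷ xs) e (there z∈) p with P x | Q x
  ... | true  | true  = filter-∧-full xs (suc-injective e) z∈ p
  ... | true  | false = contradiction (≤-reflexive (sym e)) (≤⇒≯ (length-filter-∧-≤ xs))
  ... | false | _     = filter-∧-full xs e z∈ p

module Counting (Γ : Digraph) where
  open Digraph Γ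

  count-witness : ∀ P → count Γ P ≢ 0 → ∃[ z ] T (P z)
  count-witness P c≢0 with filterᵇ P (allFin n) in eq
  ... | []     = contradiction refl c≢0
  ... | z ∷ zs = z , proj₂ (∈-filter⁻ (T? ∘ P) {xs = allFin n} (subst (z ∈_) (sym eq) (here refl)))

  count-nonzero : ∀ P z → T (P z) → count Γ P ≢ 0
  count-nonzero P z p e with filterᵇ P (allFin n) | ∈-filter⁺ (T? ∘ P) (∈-allFin z) p
  ... | _ ∷ _ | _ = contradiction e λ ()

  ==ᴾ⇒≡ : ∀ {i j} → T (_==ᴾ_ Γ i j) → i ≡ j
  ==ᴾ⇒≡ {a , b} {c , d} t with Equivalence.to T-∧ t
  ... | s , u = cong₂ _,_ (≡ᵇ⇒≡ a c s) (≡ᵇ⇒≡ b d u)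

  ≡⇒==ᴾ : ∀ {i j} → i ≡ j → T (_==ᴾ_ Γ i j)
  ≡⇒==ᴾ {a , b} refl = Equivalence.from T-∧ (≡⇒≡ᵇ a a refl , ≡⇒≡ᵇ b b refl)

  pnum-witness : ∀ x y {i j} → pnum Γ x y i j ≢ 0 → ∃[ z ] (dpair Γ x z ≡ i × dpair Γ z y ≡ j)
  pnum-witness x y p≢0 with count-witness _ p≢0
  ... | z , t with Equivalence.to T-∧ t
  ... | s , u = z , ==ᴾ⇒≡ s , ==ᴾ⇒≡ u

  pnum-nonzero : ∀ {x y z i j} → dpair Γ x z ≡ i → dpair Γ z y ≡ j → pnum Γ x y i j ≢ 0
  pnum-nonzero {z = z} s u = count-nonzero _ z (Equivalence.from T-∧ (≡⇒==ᴾ s , ≡⇒==ᴾ u))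

-- The combinatorics sees intersection numbers only through their being nonzero (`transfer`,
-- `commute`) or full: `thick-out` says that the number for `i` and its transpose, once nonzero, is
-- the whole valency.
record IsThickScheme {n : ℕ} (d : Fin n → Fin n → ℕ) : Set where
  d̃ : Fin n → Fin n → ℕ × ℕ
  d̃ x y = d x y , d y x

  field
    d-refl     : ∀ x → d x x ≡ 0
    d≡0        : ∀ {x y} → d x y ≡ 0 → x ≡ y
    triangle   : ∀ x y z → d x z ≤ d x y + d y z
    first-step : ∀ {x y k} → d x y ≡ suc k → ∃[ z ] (d x z ≡ 1 × d z y ≡ k)
    transfer   : ∀ {x y x′ y′ z i j} → d̃ x y ≡ d̃ x′ y′ → d̃ x z ≡ i → d̃ z y ≡ j →
                 ∃[ z′ ] (d̃ x′ z′ ≡ i × d̃ z′ y′ ≡ j)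
    commute    : ∀ {x y z i j} → d̃ x z ≡ i → d̃ z y ≡ j → ∃[ z′ ] (d̃ x z′ ≡ j × d̃ z′ y ≡ i)
    thick-out  : ∀ {x y z w i} → d̃ x z ≡ i → d̃ y z ≡ i → d̃ x w ≡ i → d̃ y w ≡ i

-- Arc types and their classes in a thick scheme

module ArcTypes {n : ℕ} {d : Fin n → Fin n → ℕ} (S : IsThickScheme d) where
  open IsThickScheme S

  d̃-swap : ∀ {x y a b} → d̃ x y ≡ (a , b) → d̃ y x ≡ (b , a)
  d̃-swap refl = refl

  A : ℕ → Fin n → Fin n → Set
  A t x y = d̃ x y ≡ (1 , t)

  forth : ∀ {t x y} → A t x y → d x y ≡ 1
  forth = proj₁ ∘ ,-injective

  back : ∀ {t x y} → A t x y → d y x ≡ t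
  back = proj₂ ∘ ,-injective

  type-unique : ∀ {s t x y} → A s x y → A t x y → s ≡ t
  type-unique a b = trans (sym (back a)) (back b)

  A-irrefl : ∀ {t x} → ¬ A t x x
  A-irrefl {x = x} a = contradiction (trans (sym (forth a)) (d-refl x)) λ ()

  ¬A-zero : ∀ {x y} → ¬ A 0 x y
  ¬A-zero a with d≡0 (back a)
  ... | refl = A-irrefl a

  ¬two-way : ∀ {m t x y} → A (suc (suc m)) x y → ¬ A t y x
  ¬two-way a b = contradiction (trans (sym (back a)) (forth b)) λ ()

  step-left : ∀ {t x y} z → A t x y → d x z ≤ suc (d y z)
  step-left {x = x} {y} z a = subst (λ k → d x z ≤ k + d y z) (forth a) (triangle x y z)

  step-right : ∀ {t x y} z → A t x y → d z y ≤ suc (d z x)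
  step-right {x = x} {y} z a = ≤-trans (triangle z x y)
    (≤-reflexive (trans (cong (d z x +_) (forth a)) (+-comm (d z x) 1)))

  d≤2 : ∀ {s t x y z} → A s x y → A t y z → d x z ≤ 2
  d≤2 {x = x} {z = z} a b = ≤-trans (step-left z a) (s≤s (≤-reflexive (forth b)))

  regular : ∀ {t u v} → A t u v → ∀ x → ∃[ z ] A t x z
  regular {u = u} a x with transfer {u} {u} {x} {x} (cong₂ _,_ d-const d-const) a (d̃-swap a)
    where
    d-const : d u u ≡ d x x
    d-const = trans (d-refl u) (sym (d-refl x))
  ... | z , b , _ = z , b

  K : ℕ → Fin n → Fin n → Set
  K t x y = ∃[ z ] (A t x z × A t y z)

  K-out : ∀ {t x y w} → K t x y → A t x w → A t y w
  K-out (z , a , b) c = thick-out a b c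

  fork⇒K : ∀ {t x y w} → A t w x → A t w y → K t x y
  fork⇒K a b with commute (d̃-swap a) b
  ... | z , c , e = z , c , d̃-swap e

  -- Commutativity turns the common out-neighbour into a common in-neighbour `v`, to which thickness
  -- for the transposed pair applies.
  K-in : ∀ {t x y w} → K t x y → A t w x → A t w y
  K-in (z , a , b) c with commute a (d̃-swap b)
  ... | v , e , f = d̃-swap (thick-out e (d̃-swap f) (d̃-swap c))

  K-sym : ∀ {t x y} → K t x y → K t y x
  K-sym (z , a , b) = z , b , a

  K-trans : ∀ {t x y z} → K t x y → K t y z → K t x z
  K-trans (w , a , b) k = w , a , K-out k b

  K-transfer : ∀ {t x y x′ y′} → d̃ x y ≡ d̃ x′ y′ → K t x y → K t x′ y′
  K-transfer e (z , a , b) with transfer e a (d̃-swap b)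
  ... | z′ , a′ , b′ = z′ , a′ , d̃-swap b′

  A⊆K : ∀ {s t u v x y} → A s u v → K t u v → A s x y → K t x y
  A⊆K a k b = K-transfer (trans a (sym b)) k

  -- Walks with prescribed arc types

  W : List ℕ → Fin n → Fin n → Set
  W []       x y = x ≡ y
  W (t ∷ ts) x y = ∃[ z ] (A t x z × W ts z y)

  W-resp-↭ : ∀ {ts us x y} → ts ↭ us → W ts x y → W us x y
  W-resp-↭ ↭-refl w = w
  W-resp-↭ (prep t p) (z , a , w) = z , a , W-resp-↭ p w
  W-resp-↭ (↭-swap s t p) (z , a , z′ , b , w) with commute a b
  ... | z″ , b′ , a′ = z″ , b′ , z′ , a′ , W-resp-↭ p w
  W-resp-↭ (↭-trans p q) w = W-resp-↭ q (W-resp-↭ p w)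

  d≤length : ∀ ts {x y} → W ts x y → d x y ≤ length ts
  d≤length []       {x} refl = ≤-reflexive (d-refl x)
  d≤length (t ∷ ts) {y = y} (z , a , w) = ≤-trans (step-left y a) (s≤s (d≤length ts w))

  d≤power : ∀ k {t x y} → W (replicate k t) x y → d x y ≤ k
  d≤power k {t} w = ≤-trans (d≤length (replicate k t) w) (≤-reflexive (length-replicate k))

  geodesic-types : ∀ {k x y} → d x y ≡ k → ∃[ ts ] (length ts ≡ k × W ts x y)
  geodesic-types {zero}  e = [] , refl , d≡0 e
  geodesic-types {suc k} e with first-step e
  ... | z , f , g with geodesic-types g
  ... | ts , len , w = _ ∷ ts , cong suc len , z , cong₂ _,_ f refl , w

  ∈⇒↭∷ : ∀ {t : ℕ} {ts} → t ∈ ts → ∃[ us ] (ts ↭ t ∷ us)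
  ∈⇒↭∷ t∈ with ∈-∃++ t∈
  ... | us , vs , refl = us ++ vs , shift _ us vs

  W-K : ∀ {t ts x y z} → K t x y → W (t ∷ ts) x z → W (t ∷ ts) y z
  W-K k (v , a , w) = v , K-out k a , w

  -- The second vertices of the two walks are `K t`-related, so by `W-K` the second walk can
  -- continue from that of the first.
  powers⇒K : ∀ k {t x y z} → W (replicate (suc k) t) z x → W (replicate (suc k) t) z y → K t x y
  powers⇒K zero    (x , a , refl) (y , b , refl) = fork⇒K a b
  powers⇒K (suc k) (u , a , w)    (v , b , w′)   = powers⇒K k w (W-K (fork⇒K b a) w′)

  power⊆K : ∀ k {s t x y} → (∀ {x y} → A s x y → K t x y) → W (replicate (suc k) s) x y → K t x y
  power⊆K zero    s⊆t (y , a , refl) = s⊆t a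
  power⊆K (suc k) s⊆t (v , a , w)    = K-trans (s⊆t a) (power⊆K k s⊆t w)

  power-snoc : ∀ k {t x y z} → W (replicate k t) x y → A t y z → W (replicate (suc k) t) x z
  power-snoc zero    refl a = _ , a , refl
  power-snoc (suc k) (v , b , w) a = v , b , power-snoc k w a

  -- Only the arc following a given arc of a shortest circuit is inspected: since arc types on a circuit can be
  -- permuted, this is equivalent to purity, and it is decidable.
  PureType : ℕ → Set
  PureType t = ∀ {x y z s} → A t x y → A s y z → d z x < t → s ≡ t

  MixedType : ℕ → Set
  MixedType t = ∃[ x ] ∃[ y ] ∃[ z ] (A t x y × A (d z y) y z × d z x < t × d z y ≢ t)

  pure? : ∀ t → PureType t ⊎ MixedType t
  pure? t with any? (λ x → any? λ y → any? λ z →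
    ≡-dec _≟_ _≟_ (d̃ x y) (1 , t) ×-dec ≡-dec _≟_ _≟_ (d̃ y z) (1 , d z y) ×-dec d z x <? t ×-dec ¬? (d z y ≟ t))
  ... | yes mixed = inj₂ mixed
  ... | no ¬mixed = inj₁ λ {x} {y} {z} a b lt → trans (sym (back b)) (decidable-stable (d z y ≟ t)
    λ ne → ¬mixed (x , y , z , a , trans b (cong (1 ,_) (sym (back b))) , lt , ne))

  constant-list : ∀ {t} (us : List ℕ) → (∀ {s} → s ∈ us → s ≡ t) → us ≡ replicate (length us) t
  constant-list []       h = refl
  constant-list (u ∷ us) h = cong₂ _∷_ (h (here refl)) (constant-list us (h ∘ there))

  -- Any type on a geodesic from `y` to `x` can be moved to the place right after the arc `a`, where
  -- purity applies.
  pure-return : ∀ {t x y} → PureType t → A t x y → W (replicate t t) y x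
  pure-return {t} {x} {y} pure a with geodesic-types (back a)
  ... | us , refl , w = subst (λ vs → W vs y x) (constant-list us all-t) w
    where
    all-t : ∀ {s} → s ∈ us → s ≡ t
    all-t s∈ with ∈⇒↭∷ s∈
    ... | vs , p with W-resp-↭ p w
    ... | z , b , w′ = pure a b (≤-trans (s≤s (d≤length vs w′)) (≤-reflexive (sym (↭-length p))))

  K⇒power : ∀ {t x y} → PureType t → K t x y → W (replicate (suc t) t) x y
  K⇒power pure (z , a , b) = z , a , pure-return pure b

  K⇒d≤ : ∀ {t x y} → PureType t → K t x y → d x y ≤ suc t
  K⇒d≤ {t} pure k = d≤power (suc t) (K⇒power pure k)

  -- By purity the first arc closes up to a circuit, so both ends are reached from `z` by equally
  -- many arcs of the same type.
  power⇒K : ∀ {t x y} → PureType t → W (replicate (suc t) t) x y → K t x y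
  power⇒K {zero}  pure (z , a , w) = contradiction a ¬A-zero
  power⇒K {suc t} pure (z , a , w) = powers⇒K t (pure-return pure a) w

  -- Corners: chords and skips

  near : ∀ {p x z} → d x z ≤ 2 → d z x ≡ suc p → A (suc p) x z ⊎ d̃ x z ≡ (2 , suc p)
  near {p} {x} {z} le e with d x z in eq | le
  ... | 0 | _ with d≡0 eq
  ... | refl = contradiction (trans (sym e) (d-refl x)) λ ()
  near le e | 1 | _ = inj₁ (cong (1 ,_) e)
  near le e | 2 | _ = inj₂ (cong (2 ,_) e)
  near le e | suc (suc (suc _)) | s≤s (s≤s ())

  corner-dist : ∀ {r s x y z} → A (suc r) x y → A s y z → d z x ≤ r → d z x ≡ r
  corner-dist {x = x} a b le = ≤-antisym le (≤-pred (≤-trans (≤-reflexive (sym (back a))) (step-left x b)))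

  corner : ∀ {p t x y z} → A (suc (suc p)) x y → A t y z → d z x ≤ suc p →
    A (suc p) x z ⊎ d̃ x z ≡ (2 , suc p)
  corner a b le = near (d≤2 a b) (corner-dist a b le)

  -- This is nonvanishing of the intersection number of `(1 , suc r)` and `(1 , t)` at `h`.
  Corner : ℕ → ℕ → ℕ × ℕ → Set
  Corner r t h = ∃[ x ] ∃[ y ] ∃[ z ] (A (suc r) x y × A t y z × d̃ x z ≡ h)

  -- C(r+2) and D(r+2) ask for Chord r (r+1) and Chord r r respectively.
  Chord : ℕ → ℕ → Set
  Chord r t = Corner r t (1 , r)

  Skip : ℕ → ℕ → Set
  Skip r t = Corner r t (2 , r)

  corner-at : ∀ {r t h x z} → Corner r t h → d̃ x z ≡ h → ∃[ y ] (A (suc r) x y × A t y z)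
  corner-at (_ , _ , _ , a , b , e) e′ = transfer (trans e (sym e′)) a b

  -- The third vertex of the triangle is a common `A r`-out-neighbour. Thus under D the arcs one
  -- type higher stay inside the classes of `K r`.
  chord⊆K : ∀ {r x y} → Chord r r → A (suc r) x y → K r x y
  chord⊆K (_ , _ , z , a , b , c) = A⊆K a (z , c , b)

  closed-corner : ∀ {p t us x} → W (suc (suc p) ∷ t ∷ us) x x → length us ≡ suc p →
    Chord (suc p) t ⊎ Skip (suc p) t
  closed-corner {us = us} (y , a , z , b , w) e
    with corner a b (≤-trans (d≤length us w) (≤-reflexive e))
  ... | inj₁ c = inj₁ (_ , y , z , a , b , c)
  ... | inj₂ c = inj₂ (_ , y , z , a , b , c)

  replace : ∀ {p s t us x} → Skip (suc p) s → W (suc (suc p) ∷ t ∷ us) x x → length us ≡ suc p →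
    Chord (suc p) t ⊎ W (suc (suc p) ∷ s ∷ us) x x
  replace {us = us} skip (y , a , z , b , w) e
    with corner a b (≤-trans (d≤length us w) (≤-reflexive e))
  ... | inj₁ c = inj₁ (_ , y , z , a , b , c)
  ... | inj₂ c with corner-at skip c
  ... | y′ , a′ , b′ = inj₂ (y′ , a′ , z , b′ , w)

  -- `k` counts the types already replaced; each remaining one is moved to second place and
  -- exchanged there.
  replace-all : ∀ {p s x} → Skip (suc p) s → ∀ k us → k + length us ≡ suc (suc p) →
    W (suc (suc p) ∷ replicate k s ++ us) x x →
    ∃ (Chord (suc p)) ⊎ W (suc (suc p) ∷ replicate (suc (suc p)) s) x x
  replace-all {p} {s} {x} skip k [] e w = inj₂ (subst (λ us → W (suc (suc p) ∷ us) x x)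
    (trans (++-identityʳ (replicate k s)) (cong (λ l → replicate l s) (trans (sym (+-identityʳ k)) e))) w)
  replace-all {p} {s} {x} skip k (t ∷ us) e w
    with replace skip (W-resp-↭ (prep _ (shift t (replicate k s) us)) w) len
    where
    len : length (replicate k s ++ us) ≡ suc p
    len = trans (length-++ (replicate k s)) (trans (cong (_+ length us) (length-replicate k))
      (suc-injective (trans (sym (+-suc k (length us))) e)))
  ... | inj₁ c  = inj₁ (t , c)
  ... | inj₂ w′ = replace-all skip (suc k) us (trans (sym (+-suc k (length us))) e) w′

  -- Under C the relations A s and A (s+1) ∘ A (s+1) agree up to K (s+1).
  square : ∀ {s x a b} → Chord s (suc s) → A (suc s) x a → A (suc s) a b → ∃[ e ] (A s x e × K (suc s) b e)
  square {x = x} C@(_ , _ , _ , _ , _ , c) a b with regular c x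
  ... | e , c′ with corner-at C c′
  ... | a′ , a″ , b″ = e , c′ , fork⇒K b (K-out (fork⇒K a″ a) b″)

  -- `square` is exact only up to `K (suc s)`; the third arc absorbs the difference.
  shorten-cube : ∀ {s us x y} → Chord s (suc s) → W (suc s ∷ suc s ∷ suc s ∷ us) x y → W (s ∷ suc s ∷ us) x y
  shorten-cube C (_ , a , _ , b , c , f , w) with square C a b
  ... | e , g , k = e , g , c , K-out k f , w

  power-split : ∀ k {l t x y} → W (replicate (k + l) t) x y → ∃[ z ] (W (replicate k t) x z × W (replicate l t) z y)
  power-split zero    w = _ , refl , w
  power-split (suc k) (v , a , w) with power-split k w
  ... | z , w₁ , w₂ = z , (v , a , w₁) , w₂

  -- Consequences of resolved types

  Configuration : ℕ → Set
  Configuration r = PureType r × (Chord r (suc r) ⊎ Chord r r)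

  Resolved : ℕ → Set
  Resolved t = PureType t ⊎ ∃[ r ] (t ≡ suc r × Configuration r)

  square-return : ∀ {t x a b} → Resolved (suc (suc t)) → A (suc (suc t)) x a → A (suc (suc t)) a b →
    d b x ≤ suc (suc t)
  square-return {t} (inj₁ pure) a b with pure-return pure a
  ... | b₁ , b′ , w = m≤n⇒m≤1+n (d≤power (suc t) (W-K (fork⇒K b′ b) w))
  square-return (inj₂ (_ , refl , pure , inj₂ D)) a b =
    K⇒d≤ pure (K-sym (K-trans (chord⊆K D a) (chord⊆K D b)))
  square-return {t} (inj₂ (_ , refl , pure , inj₁ C)) a b with square C a b
  ... | e , c , k with pure-return pure c
  -- Splitting the first returning arc by C yields an arc of type `suc (suc t)` out of `e`, which
  -- can then start at `b` instead.
  ... | f , g , w with corner-at C g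
  ... | e′ , h , i =
    ≤-trans (d≤length (suc (suc t) ∷ suc (suc t) ∷ replicate t (suc t)) (e′ , K-out (K-sym k) h , f , i , w))
      (≤-reflexive (cong (2 +_) (length-replicate t)))

  -- Since d y x = r+1 for the first arc x → y, the r+1 arcs of type s from y to x form a geodesic; every case
  -- but "s = r and pure" provides a shortcut.
  uniform-circuit : ∀ {p s x} → Resolved s → s ≤ suc p →
    W (suc (suc p) ∷ replicate (suc (suc p)) s) x x → Configuration (suc p)
  uniform-circuit {p} {s} {x} (inj₁ pure) s≤r (y , a , w) with m≤n⇒m<n∨m≡n s≤r
  ... | inj₂ refl with power⇒K pure w
  ... | z , b , c = pure , inj₂ (x , y , z , a , b , c)
  uniform-circuit {p} {s} {x} (inj₁ pure) s≤r (y , a , w) | inj₁ s<r with m≤n⇒∃[o]m+o≡n s<r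
  -- The first `suc s` arcs stay in a class of `K s`, so the remaining `suc o` arcs can start at `y`
  -- already.
  ... | o , e with power-split (suc s) {suc o} (subst (λ k → W (replicate k s) y x) (sym (trans (+-suc (suc s) o) (cong suc e))) w)
  ... | z , w₁ , w₂ = contradiction
    (≤-trans (≤-reflexive (sym (back a))) (d≤power (suc o) (W-K (K-sym (power⇒K pure w₁)) w₂)))
    (<⇒≱ (s≤s (≤-trans (s≤s (m≤n+m o s)) (≤-reflexive e))))
  uniform-circuit {p} (inj₂ (s , refl , pure , inj₂ D)) s≤r (y , a , w) = contradiction
    (≤-trans (≤-reflexive (sym (back a))) (K⇒d≤ pure (power⊆K (suc p) (chord⊆K D) w)))
    (<⇒≱ (s≤s s≤r))
  uniform-circuit {zero} (inj₂ (zero , refl , pure , inj₁ (_ , _ , _ , _ , _ , c))) s≤r w = contradiction c ¬A-zero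
  uniform-circuit {zero} (inj₂ (suc s , refl , pure , inj₁ C)) (s≤s ()) w
  uniform-circuit {suc p} (inj₂ (s , refl , pure , inj₁ C)) s≤r (y , a , w) = contradiction
    (≤-trans (≤-reflexive (sym (back a))) (d≤length (s ∷ suc s ∷ replicate p (suc s)) (shorten-cube C w)))
    (<⇒≱ (s≤s (s≤s (s≤s (≤-reflexive (length-replicate p))))))

  -- The circuit r+1 , t , r , … , r contains corners (r+1 , r) and (t , r).  If the first is not a chord then both
  -- have two-way distance (2 , r), so r+1 can be replaced by t, which forces A r ⊆ A t ∘ A t.
  pure-chord : ∀ {p t} → PureType (suc p) → Resolved t → t < suc p → Chord (suc p) t → Chord (suc p) (suc p)
  pure-chord {p} {t} pure res t<r (x , y , z , a , b , c) = from-circuit (y , a , z , b , pure-return pure c)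
    where
    r : ℕ
    r = suc p

    rs : List ℕ
    rs = replicate p r

    repeated : ∀ {t u v} → Resolved t → t < r → A t x u → A t u v → ¬ A r x v
    repeated {zero}        _   _   f g h = ¬A-zero f
    repeated {suc zero}    _   1<r f g h = <⇒≢ 1<r
      (pure h (d̃-swap g) (≤-trans (≤-reflexive (cong suc (back f))) 1<r))
    repeated {suc (suc _)} res t<r f g h = <⇒≱ t<r
      (≤-trans (≤-reflexive (sym (back h))) (square-return res f g))

    collapse : W (t ∷ r ∷ t ∷ rs) x x → Chord r r
    -- The last `r` arcs lead from `v` to `x`; one more, `h`, gives `K r v e`, hence an arc of type
    -- `r` from `x` to `v`.
    collapse w with W-resp-↭ (prep t (↭-swap r t ↭-refl)) w | regular c x
    ... | u , f , v , g , w′ | e , h = contradiction (K-in (K-sym (power⇒K pure (power-snoc r w′ h))) h) (repeated res t<r f g)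

    from-circuit : W (suc r ∷ t ∷ r ∷ rs) x x → Chord r r
    from-circuit w
      with W-resp-↭ (prep _ (↭-swap t r ↭-refl)) w
         | W-resp-↭ (↭-trans (↭-swap (suc r) t ↭-refl) (prep t (↭-swap (suc r) r ↭-refl))) w
    ... | y₁ , a₁ , z₁ , b₁ , w₁ | y₂ , a₂ , z₂ , b₂ , w₂
      with corner a₁ b₁ (≤-trans (d≤length (t ∷ rs) w₁) (s≤s (≤-reflexive (length-replicate p))))
         | m≤n⇒m<n∨m≡n (≤-trans (d≤length (suc r ∷ rs) w₂) (s≤s (≤-reflexive (length-replicate p))))
    ... | inj₁ c₁ | _ = x , y₁ , z₁ , a₁ , b₁ , c₁
    ... | inj₂ e₁ | inj₁ lt with commute a₂ b₂
    ... | _ , b′ , a′ = contradiction (pure b′ a′ lt) (<⇒≢ t<r)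
    from-circuit w | y₁ , a₁ , z₁ , b₁ , w₁ | y₂ , a₂ , z₂ , b₂ , w₂ | inj₂ e₁ | inj₂ e
      with near (d≤2 a₂ b₂) e
    -- Here arcs of type `t` lie in `K r`, so `b` moves the end of `c` from `z` to `y`.
    ... | inj₁ c₂ = contradiction
      (type-unique (K-in (K-sym (A⊆K a₂ (z₂ , c₂ , b₂) b)) c) a) (<⇒≢ ≤-refl)
    ... | inj₂ e₂ with transfer (trans e₂ (sym e₁)) a₂ b₂
    ... | y₃ , a₃ , b₃ = collapse (y₃ , a₃ , z₁ , b₃ , w₁)

  -- All pairs at two-way distance (2 , p+1) are corners of types (p+2 , p); in particular none lies inside a
  -- class of K p, nor joins the classes of the two ends of an arc of type p+2.  The path x → u → z → w with
  -- types t , p+2 , p+1 and x → z of type p+1 produces such a pair.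
  chordD-absurd : ∀ {p t} → PureType p → Chord p p → ¬ Chord (suc p) t
  chordD-absurd {zero} pure (_ , _ , _ , _ , _ , c) _ = ¬A-zero c
  chordD-absurd {p@(suc _)} {t} pure D (x , y , z , a , b , c) = absurd
    where
    r m : ℕ
    r = suc p
    m = suc r

    returning : W (replicate (suc p) p) z x
    returning = K⇒power pure (K-sym (chord⊆K D c))

    skip : Skip r p
    skip with W-resp-↭ {ts = m ∷ t ∷ replicate (suc p) p} (prep m (↭-swap t p ↭-refl)) (y , a , z , b , returning)
    ... | y₁ , a₁ , z₁ , b₁ , w₁ with corner a₁ b₁
      (≤-trans (d≤length (t ∷ replicate p p) w₁) (s≤s (≤-reflexive (length-replicate p))))
    ... | inj₁ c₁ = contradiction (K-in (K-sym (chord⊆K D c₁)) b₁) (¬two-way a₁)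
    ... | inj₂ e  = x , y₁ , z₁ , a₁ , b₁ , e

    skip-∉K : ∀ {u v} → d̃ u v ≡ (2 , r) → ¬ K p u v
    skip-∉K e k with corner-at skip e
    ... | w , f , g = ¬two-way f (K-in (K-sym k) g)

    skip-∉AK : ∀ {u v w} → d̃ u v ≡ (2 , r) → A m u w → ¬ K p w v
    skip-∉AK e f k with corner-at skip e | commute a b
    -- The arc of type `p` from `w′` to `w` lies in `K m`, hence so do all such arcs and the walk
    -- `returning`. Moving the end of `a′` to `x` reverses `b′`.
    ... | w′ , g , h | y′ , b′ , a′ = ¬two-way (K-in (power⊆K p (A⊆K (K-in (K-sym k) h) (fork⇒K g f)) returning) a′) b′

    absurd : ⊥
    absurd with commute a b | regular c z
    ... | u , b′ , a′ | w , e
      with m≤n⇒m<n∨m≡n (K⇒d≤ pure (K-sym (K-trans (chord⊆K D c) (chord⊆K D e))))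
    ... | inj₂ d≡r with near (d≤2 c e) d≡r
    ... | inj₁ f = A-irrefl (K-out (fork⇒K c f) e)
    ... | inj₂ f = skip-∉K f (K-trans (chord⊆K D c) (chord⊆K D e))
    absurd | u , b′ , a′ | w , e | inj₁ d<r with corner a′ e (≤-trans (step-right w b′) d<r)
    ... | inj₁ f = contradiction
      (≤-trans (≤-reflexive (sym (back a′))) (K⇒d≤ pure (K-trans (chord⊆K D e) (K-sym (chord⊆K D f)))))
      (<⇒≱ ≤-refl)
    ... | inj₂ f = skip-∉AK f a′ (chord⊆K D e)

  -- Excluding chords one level above C

  module _ {p : ℕ} (pure : PureType p) (C : Chord p (suc p)) where
    private
      r m : ℕ
      r = suc p
      m = suc r

    third-side : ∀ {x z} → A r x z → ∃[ w ] (A r z w × A p x w)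
    third-side {x} c with regular (proj₂ (proj₂ (proj₂ (proj₂ (proj₂ C))))) x
    ... | w , e with corner-at C e
    ... | z′ , f , g = w , K-out (fork⇒K f c) g , e

    ¬chord-p : ¬ Chord r p
    ¬chord-p (x , y , z , a , b , c) with corner-at C b
    ... | u , f , g = ¬two-way a (K-in (z , g , c) f)

    -- Both skips are realised over the same pair. By C their middle vertices are joined by an arc
    -- of type `r`, so arcs of type `r` lie in `K m`; then `c` turns `a′` into an arc opposite to
    -- `b′`.
    ¬skips : ∀ {t} → Chord r t → Skip r p → ¬ Skip r r
    ¬skips (x , y , z , a , b , c) skip-p (_ , y₁ , z₁ , a₁ , b₁ , e₁) with corner-at skip-p e₁ | commute a b
    ... | y′ , f , g | y″ , b′ , a′ with corner-at C g
    ... | u , h , i = ¬two-way (K-in (K-sym (A⊆K (K-in (z₁ , i , b₁) h) (fork⇒K f a₁) c)) a′) b′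

    -- In both outcomes of `corner` some path of two `r`-arcs leads from `y` to `w`, and its middle
    -- vertex is `K r`-related to `z`.
    other-side : ∀ {s p′ y z w w′} → p ≡ suc p′ → A r y z → A s z w → d w y ≤ p →
      A r z w′ → d̃ y w′ ≡ (2 , p) → s ≡ r
    other-side refl b f le g e with corner b f le
    ... | inj₁ c with corner-at C c
    ... | z′ , b′ , h = type-unique f (K-out (fork⇒K b′ b) h)
    other-side refl b f le g e | inj₂ e′ with transfer (trans e (sym e′)) b g
    ... | z′ , b′ , h = type-unique f (K-out (fork⇒K b′ b) h)

    ¬chord-r : Skip r p → ¬ Chord r r
    ¬chord-r skip-p chord@(x , y , z , a , b , c) with third-side c
    ... | w , f , e = distances (m≤n⇒m<n∨m≡n (≤-trans (step-right w a) (≤-reflexive (cong suc (back e)))))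
      where
      d-yw≢1 : d y w ≢ 1
      d-yw≢1 eq = <⇒≱ ≤-refl
        (≤-trans (≤-reflexive (sym (back a))) (≤-trans (triangle y w x) (≤-reflexive (cong₂ _+_ eq (back e)))))

      short : ∀ us → length us ≡ p → W us w y → ⊥
      short [] refl _ = ¬A-zero e
      short (s ∷ us) refl (v , g , w₁) with corner b f (d≤length (s ∷ us) (v , g , w₁))
      ... | inj₁ h = d-yw≢1 (forth h)
      ... | inj₂ h with commute f g
      ... | w′ , g′ , f′ with other-side refl b g′ (d≤length (r ∷ us) (v , f′ , w₁)) f h
      -- The closed walk now begins with three `r`-arcs. After shortening, the arc `i` of type `r`
      -- has a return of only `p` arcs.
      ... | refl with W-resp-↭ (↭-swap p r ↭-refl) (shorten-cube {us = us} C (z , b , w , f , v , g , w₁))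
      ... | u , i , w₂ = <⇒≱ ≤-refl (≤-trans (≤-reflexive (sym (back i))) (d≤length (p ∷ us) w₂))

      distances : d w y < r ⊎ d w y ≡ r → ⊥
      distances (inj₁ lt) with geodesic-types (corner-dist b f (≤-pred lt))
      ... | us , len , w₁ = short us len w₁
      distances (inj₂ eq) with near (d≤2 b f) eq
      ... | inj₁ h = d-yw≢1 (forth h)
      ... | inj₂ h with corner-at skip-p h
      -- The common out-neighbour `w` gives `K p u x`, which bounds `d u x` by `r`.
      ... | u , g , i with corner a g (K⇒d≤ pure (w , i , e))
      ... | inj₁ j = A-irrefl (K-out (K-trans (chord⊆K chord a) (chord⊆K chord g)) j)
      ... | inj₂ j with corner-at skip-p j
      ... | y′ , k , l = contradiction (type-unique (K-out (fork⇒K a k) g) l) (>⇒≢ (m≤n⇒m≤1+n ≤-refl))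

    -- The circuit p+2 , t , p+1 , p , … , p shows that types p and p+1 each form a chord or a skip.
    chordC-absurd : ∀ {t} → ¬ Chord r t
    chordC-absurd {t} chord@(x , y , z , a , b , c) with third-side c
    ... | w , f , e = circuit p refl (y , a , z , b , w , f , pure-return pure e)
      where
      circuit : ∀ q → q ≡ p → W (m ∷ t ∷ r ∷ replicate q p) x x → ⊥
      circuit zero    refl w = ¬A-zero e
      circuit (suc q) refl w
        with closed-corner (W-resp-↭ (prep m (shift p (t ∷ r ∷ []) (replicate q p))) w) (cong (2 +_) (length-replicate q))
           | closed-corner (W-resp-↭ (prep m (↭-swap t r ↭-refl)) w) (cong (2 +_) (length-replicate q))
      ... | inj₁ chord-p | _            = ¬chord-p chord-p
      ... | inj₂ skip-p  | inj₁ chord-r = ¬chord-r skip-p chord-r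
      ... | inj₂ skip-p  | inj₂ skip-r  = ¬skips chord skip-p skip-r

  -- Induction on the type

  chord⇒configuration : ∀ {p t} → (∀ {s} → s < suc (suc p) → Resolved s) → Chord (suc p) t → Configuration (suc p)
  chord⇒configuration {p} {t} rec chord@(x , y , z , a , b , c) with rec {suc p} ≤-refl
  ... | inj₂ (_ , refl , pure , inj₁ C) = contradiction chord (chordC-absurd pure C)
  ... | inj₂ (_ , refl , pure , inj₂ D) = contradiction chord (chordD-absurd pure D)
  -- The second type is at most `suc (d z x)`: equality is C, one less is D, and `pure-chord` turns
  -- anything smaller into D.
  ... | inj₁ pure with m≤n⇒m<n∨m≡n (≤-trans (≤-trans (≤-reflexive (sym (back b))) (step-right z a)) (s≤s (≤-reflexive (back c))))
  ... | inj₂ refl = pure , inj₁ chord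
  ... | inj₁ t<m with m≤n⇒m<n∨m≡n (≤-pred t<m)
  ... | inj₂ refl = pure , inj₂ chord
  ... | inj₁ t<r  = pure , inj₂ (pure-chord pure (rec t<m) t<r chord)

  mixed⇒configuration : ∀ m → (∀ {s} → s < m → Resolved s) → MixedType m → ∃[ r ] (m ≡ suc r × Configuration r)
  mixed⇒configuration zero _ (_ , _ , _ , a , _) = contradiction a ¬A-zero
  mixed⇒configuration (suc zero) _ (x , y , z , a , b , lt , ne) with d≡0 (n<1⇒n≡0 lt)
  ... | refl = contradiction (forth a) ne
  mixed⇒configuration (suc (suc p)) rec (x , y , z , a , b , lt , ne) with geodesic-types (corner-dist a b (≤-pred lt))
  ... | us , len , w = suc p , refl , resolve (closed-corner {us = us} (y , a , z , b , w) len)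
    where
    s<m : d z y < suc (suc p)
    s<m = ≤∧≢⇒< (≤-trans (step-right z a) lt) ne

    resolve : Chord (suc p) (d z y) ⊎ Skip (suc p) (d z y) → Configuration (suc p)
    resolve (inj₁ chord) = chord⇒configuration rec chord
    resolve (inj₂ skip) with replace-all skip 1 us (cong suc len) (y , a , z , b , w)
    ... | inj₁ (_ , chord) = chord⇒configuration rec chord
    ... | inj₂ circuit     = uniform-circuit (rec s<m) (≤-pred s<m) circuit

  resolved : ∀ m → Resolved m
  resolved = <-rec Resolved step
    where
    step : ∀ m → (∀ {s} → s < m → Resolved s) → Resolved m
    step m rec with pure? m
    ... | inj₁ pure  = inj₁ pure
    ... | inj₂ mixed = inj₂ (mixed⇒configuration m rec mixed)

  ¬pure⇒configuration : ∀ {r} → ¬ PureType (suc r) → Configuration r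
  ¬pure⇒configuration {r} ¬pure with resolved (suc r)
  ... | inj₁ pure            = ⊥-elim (¬pure pure)
  ... | inj₂ (_ , refl , cf) = cf

  configuration⇒¬pure : ∀ {r} → Configuration r → ¬ PureType (suc r)
  configuration⇒¬pure (pure , inj₂ (x , y , z , a , b , c)) pure′ =
    contradiction (pure′ a b (s≤s (≤-reflexive (back c)))) (<⇒≢ ≤-refl)
  configuration⇒¬pure {zero} (pure , inj₁ (_ , _ , _ , _ , _ , c)) _ = ¬A-zero c
  configuration⇒¬pure {suc r} (pure , inj₁ (x , y , z , a , b , c)) pure′ with pure-return pure c
  -- The return from `z` to `x`, closed up by `a` and `b`, is a circuit on which `e`, of smaller
  -- type, follows `b`.
  ... | w , e , v = contradiction (pure′ b e (s≤s (≤-trans (step-right w a) (s≤s (d≤power r v))))) (<⇒≢ ≤-refl)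

-- From digraphs to thick schemes

module Digraphs (Γ : Digraph) (wdr : WeaklyDistanceRegular Γ) (comm : Commutative Γ) (thick : Thick Γ) where
  open Digraph Γ
  open Walks Γ
  open Counting Γ

  walk : ∀ {x y k} → dist Γ x y ≡ k → Walk k x y
  walk refl = geodesic (proj₁ wdr) _ _

  dist-refl : ∀ x → dist Γ x x ≡ 0
  dist-refl x = n≤0⇒n≡0 (dist-≤ [])

  dist≡0 : ∀ {x y} → dist Γ x y ≡ 0 → x ≡ y
  dist≡0 e with walk e
  ... | [] = refl

  dist≡1⇒adj : ∀ {x y} → dist Γ x y ≡ 1 → adj x y ≡ true
  dist≡1⇒adj e with walk e
  ... | a ∷ [] = a

  adj⇒dist≡1 : ∀ {x y} → adj x y ≡ true → dist Γ x y ≡ 1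
  adj⇒dist≡1 {x} {y} a with dist Γ x y in eq | dist-≤ (a ∷ [])
  ... | suc zero    | _ = refl
  ... | suc (suc _) | s≤s ()
  ... | zero        | _ with dist≡0 eq
  ... | refl = contradiction (trans (sym a) (loopless x)) λ ()

  dist-first-step : ∀ {x y k} → dist Γ x y ≡ suc k → ∃[ z ] (dist Γ x z ≡ 1 × dist Γ z y ≡ k)
  dist-first-step {x} {y} {k} e with walk e
  ... | _∷_ {y = z} a w = z , adj⇒dist≡1 a , ≤-antisym (dist-≤ w)
    (≤-pred (≤-trans (≤-reflexive (sym e)) (dist-≤ (a ∷ walk refl))))

  dpair-transfer : ∀ {x y x′ y′ z i j} → dpair Γ x y ≡ dpair Γ x′ y′ → dpair Γ x z ≡ i → dpair Γ z y ≡ j →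
    ∃[ z′ ] (dpair Γ x′ z′ ≡ i × dpair Γ z′ y′ ≡ j)
  dpair-transfer {x} {y} {x′} {y′} e s u = pnum-witness x′ y′
    λ p≡0 → pnum-nonzero s u (trans (proj₂ wdr x y x′ y′ _ _ e) p≡0)

  dpair-commute : ∀ {x y z i j} → dpair Γ x z ≡ i → dpair Γ z y ≡ j →
    ∃[ z′ ] (dpair Γ x z′ ≡ j × dpair Γ z′ y ≡ i)
  dpair-commute {x} {y} s u = pnum-witness x y λ p≡0 → pnum-nonzero s u (trans (comm x y _ _) p≡0)

  dpair-thick : ∀ {x y z w i} → dpair Γ x z ≡ i → dpair Γ y z ≡ i → dpair Γ x w ≡ i → dpair Γ y w ≡ i
  dpair-thick {x} {y} {z} {w} {i} s u v with proj₂ (thick x y i)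
  ... | inj₁ p≡0 = contradiction p≡0 (pnum-nonzero s (cong (swap Γ) u))
  ... | inj₂ p≡k = cong (swap Γ) (==ᴾ⇒≡ (filter-∧-full
    (λ z → _==ᴾ_ Γ (dpair Γ x z) i) (λ z → _==ᴾ_ Γ (dpair Γ z y) (swap Γ i))
    (allFin n) p≡k (∈-allFin w) (≡⇒==ᴾ v)))

  isThickScheme : IsThickScheme (dist Γ)
  isThickScheme = record
    { d-refl     = dist-refl
    ; d≡0        = dist≡0
    ; triangle   = λ x y z → dist-≤ (walk {x} {y} refl ++ʷ walk refl)
    ; first-step = dist-first-step
    ; transfer   = dpair-transfer
    ; commute    = dpair-commute
    ; thick-out  = dpair-thick
    }

  open ArcTypes isThickScheme

  Pure⇒PureType : ∀ {m} → Pure Γ m → PureType m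
  Pure⇒PureType {zero} pure a = contradiction a ¬A-zero
  Pure⇒PureType {suc m} pure {x} {y} {z} a b lt =
    trans (sym (back b)) (pure x y (dist≡1⇒adj (forth a) , back a) (vertex circuit)
      (sym (vertex-last circuit) , vertex-adj circuit) (zero , refl , refl) (suc zero))
    where
    circuit : Walk (suc (suc m)) x x
    circuit = dist≡1⇒adj (forth a) ∷ (dist≡1⇒adj (forth b) ∷ walk (corner-dist a b (≤-pred lt)))

  arc-type : ∀ {L} → (Fin (suc L) → V Γ) → Fin L → ℕ
  arc-type c i = dist Γ (c (suc i)) (c (inject₁ i))

  types : ∀ {L} → (Fin (suc L) → V Γ) → List ℕ
  types c = tabulate (arc-type c)

  types-W : ∀ L (c : Fin (suc L) → V Γ) → (∀ (i : Fin L) → adj (c (inject₁ i)) (c (suc i)) ≡ true) →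
    W (types c) (c zero) (c (fromℕ L))
  types-W zero    c h = refl
  types-W (suc L) c h = c (suc zero) , cong₂ _,_ (adj⇒dist≡1 (h zero)) refl , types-W L (c ∘ suc) (h ∘ suc)

  -- Permuting the types puts that of the given arc first and that of arc `j` second, where
  -- `PureType` compares them.
  PureType⇒Pure : ∀ {m} → PureType m → Pure Γ m
  PureType⇒Pure {m} pure u v (_ , back-uv) c (closed , h) (i , refl , refl) j with ∈⇒↭∷ (∈-tabulate⁺ {f = arc-type c} i)
  ... | ts , p with ∈-resp-↭ p (∈-tabulate⁺ {f = arc-type c} j)
  ... | here e = trans e back-uv
  ... | there j∈ with ∈⇒↭∷ j∈
  ... | us , q with W-resp-↭ (↭-trans p (prep _ q)) (subst (W (types c) (c zero)) (sym closed) (types-W (suc m) c h))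
  ... | y , a , z , b , w = pure (subst (λ t → A t (c zero) y) back-uv a) b
    (≤-trans (s≤s (d≤length us w)) (≤-pred (≤-reflexive (trans (sym (↭-length (↭-trans p (prep _ q)))) (length-tabulate (arc-type c))))))

  chord⇔C : ∀ {r} → Chord r (suc r) ⇔ PNonzero Γ (1 , r) (1 , suc r) (1 , suc r)
  chord⇔C = mk⇔ (λ (x , y , z , a , b , c) → x , z , c , pnum-nonzero a b)
    λ (x , z , c , ne) → let y , a , b = pnum-witness x z ne in x , y , z , a , b , c

  chord⇔D : ∀ {r} → Chord r r ⇔ PNonzero Γ (1 , suc r) (1 , r) (r , 1)
  chord⇔D = mk⇔ (λ (x , y , z , a , b , c) → x , y , a , pnum-nonzero c (cong (swap Γ) b))
    λ (x , y , a , ne) → let z , c , b = pnum-witness x y ne in x , y , z , a , cong (swap Γ) b , c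

theorem3p1 : (Γ : Digraph) → WeaklyDistanceRegular Γ → Commutative Γ → Thick Γ →
    (q : ℕ) → ((ConfC Γ q ⊎ ConfD Γ q) ⇔ Mixed Γ (q ∸ 1))
theorem3p1 Γ wdr comm thick = λ where
    zero          → mk⇔ degenerate (contradiction (PureType⇒Pure pure₀))
    (suc zero)    → mk⇔ degenerate (contradiction (PureType⇒Pure pure₀))
    (suc (suc r)) → mk⇔ (λ conf → configuration⇒¬pure (from-conf conf) ∘ Pure⇒PureType)
      (λ mixed → to-conf (¬pure⇒configuration (mixed ∘ PureType⇒Pure)))
  where
  open Digraphs Γ wdr comm thick
  open ArcTypes isThickScheme using (PureType; Configuration; ¬A-zero; configuration⇒¬pure; ¬pure⇒configuration)

  pure₀ : PureType 0
  pure₀ a = contradiction a ¬A-zero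

  -- For `q` at most 1, truncated subtraction makes `(1 , 0)` the upper index in both
  -- configurations, and no pair of vertices realises it.
  degenerate : ∀ {X P Q : Set} {i j k l} → (PNonzero Γ (1 , 0) i j × P) ⊎ (PNonzero Γ (1 , 0) k l × Q) → X
  degenerate (inj₁ ((_ , _ , a , _) , _)) = contradiction a ¬A-zero
  degenerate (inj₂ ((_ , _ , a , _) , _)) = contradiction a ¬A-zero

  from-conf : ∀ {r} → ConfC Γ (suc (suc r)) ⊎ ConfD Γ (suc (suc r)) → Configuration r
  from-conf (inj₁ (c , pure)) = Pure⇒PureType pure , inj₁ (Equivalence.from chord⇔C c)
  from-conf (inj₂ (c , pure)) = Pure⇒PureType pure , inj₂ (Equivalence.from chord⇔D c)

  to-conf : ∀ {r} → Configuration r → ConfC Γ (suc (suc r)) ⊎ ConfD Γ (suc (suc r))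
  to-conf (pure , inj₁ c) = inj₁ (Equivalence.to chord⇔C c , PureType⇒Pure pure)
  to-conf (pure , inj₂ c) = inj₂ (Equivalence.to chord⇔D c , PureType⇒Pure pure)
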